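{- For every integer $n \geq 3$, the prism $C_n \,\square\, K_2$ is $(31,4)$-total-threshold-colorable.
   Context: All graphs are finite, simple and undirected. A near-far-labeling of a graph $G$ is a pair $(N,F)$ with $N \subseteq E(G)$ and $F = E(G)\setminus N$ (edges in $N$ are "near", edges in $F$ are "far"). For integers $r \geq t$, an $(r,t)$-threshold-coloring of $G$ with respect to $(N,F)$ is a map $c: V(G) \to \{0,\ldots,r-1\}$ such that $|c(u)-c(v)| \leq t$ for every $uv \in N$ and $|c(u)-c(v)| > t$ for every $uv \in F$. A graph is $(r,t)$-total-threshold-colorable if it admits an $(r,t)$-threshold-coloring with respect to every near-far-labeling. $G \,\square\, H$ denotes the Cartesian product: vertex set $V(G)\times V(H)$, with $(v,w),(x,y)$ adjacent iff either $v=x$ and $wy \in E(H)$, or $w=y$ and $vx \in E(G)$. $C_n$ is the cycle of length $n$ and $K_2$ the complete graph on two vertices. -}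

module Defs where

open import Data.Nat using (ℕ; suc; _≤_; _<_; _+_)
open import Data.Nat.DivMod using (_%_)
open import Data.Fin using (Fin; toℕ)
open import Data.Bool using (Bool; true; false)
open import Data.Product using (_×_; _,_; Σ)
open import Data.Sum using (_⊎_)
open import Relation.Binary.PropositionalEquality using (_≡_)

-- A graph given by a vertex type and an adjacency relation.
-- The concrete graphs below have symmetric, irreflexive adjacency by construction.
record Graph : Set₁ where
  field
    V   : Set
    Adj : V → V → Set
open Graph public

dist : ℕ → ℕ → ℕ
dist 0 b = b
dist (suc a) 0 = suc a
dist (suc a) (suc b) = dist a b

-- A near-far-labeling (N, F = E \ N): every (unordered) pair gets a label,
-- near = true means "in N", false means "in F"; only labels of edges matter.
-- Symmetry makes it a labeling of unordered edges.
record NearFarLabeling (G : Graph) : Set where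
  field
    near     : V G → V G → Bool
    near-sym : ∀ u v → near u v ≡ near v u
open NearFarLabeling public

IsThresholdColoring : (G : Graph) (r t : ℕ) → NearFarLabeling G → (V G → Fin r) → Set
IsThresholdColoring G r t L c =
  ∀ u v → Adj G u v →
    (near L u v ≡ true  → dist (toℕ (c u)) (toℕ (c v)) ≤ t) ×
    (near L u v ≡ false → t < dist (toℕ (c u)) (toℕ (c v)))

TotalThresholdColorable : (r t : ℕ) → Graph → Set
TotalThresholdColorable r t G =
  (L : NearFarLabeling G) → Σ (V G → Fin r) (IsThresholdColoring G r t L)

-- The cycle C_n (n ≥ 1 written as suc m): i adjacent to (i+1) mod n, symmetrised.
-- Simple (irreflexive, no multi-edges) exactly when n ≥ 3.
Cycle : ℕ → Graph
Cycle m = record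
  { V   = Fin (suc m)
  ; Adj = λ i j → (toℕ j ≡ suc (toℕ i) % suc m) ⊎ (toℕ i ≡ suc (toℕ j) % suc m)
  }

K2 : Graph
K2 = record { V = Fin 2 ; Adj = λ i j → ¬≡ i j }
  where
    ¬≡ : Fin 2 → Fin 2 → Set
    ¬≡ i j = (toℕ i ≡ 0 × toℕ j ≡ 1) ⊎ (toℕ i ≡ 1 × toℕ j ≡ 0)

_□_ : Graph → Graph → Graph
G □ H = record
  { V   = V G × V H
  ; Adj = λ { (v , w) (x , y) → (v ≡ x × Adj H w y) ⊎ (w ≡ y × Adj G v x) }
  }

{-# OPTIONS --safe #-}
-- Colour the prism rung by rung.  Single out one colour pair ("pivot") for near
-- rungs and one for far rungs.  For any labels on three, four or five consecutive
-- steps around the cycle, a path leads from the pivot of the first rung to the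
-- pivot of the last one; this is a finite check.  Since every n ≥ 3 is a sum of
-- terms 3, 4 and 5, such paths concatenate to a closed walk once around the cycle.
module Submission where

open import Defs
open import Data.Bool using (Bool; true; false; _∧_; T; T?)
open import Data.Bool.ListAction using (all; any)
open import Data.Bool.Properties using (T-∧; T-≡)
open import Data.Fin using (Fin; zero; suc; toℕ; fromℕ<)
open import Data.Fin.Properties using (toℕ<n; toℕ-fromℕ<; toℕ-injective)
open import Data.List using (List; []; _∷_; filter; cartesianProduct; cartesianProductWith)
open import Data.List.Membership.Propositional using (_∈_; find)
open import Data.List.Membership.Propositional.Properties using (∈-cartesianProduct⁺; ∈-cartesianProductWith⁺; ∈-filter⁻)
import Data.List.Relation.Unary.All as All
open import Data.List.Relation.Unary.All.Properties using (all⁺)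
open import Data.List.Relation.Unary.Any using (here; there)
open import Data.List.Relation.Unary.Any.Properties using (any⁻)
open import Data.Nat using (ℕ; zero; suc; _+_; _∸_; _≤_; _<_; _<ᵇ_; s≤s; s≤s⁻¹)
open import Data.Nat.DivMod using (_%_; _mod_; m<n⇒m%n≡m; n%n≡0; m%n<n)
open import Data.Nat.Properties using (+-comm; +-identityʳ; <⇒≤; <ᵇ⇒<; m≤n⇒m<n∨m≡n)
open import Data.Product using (_×_; _,_; ∃-syntax; proj₁; proj₂)
open import Data.Sum using (inj₁; inj₂)
open import Data.Unit using (tt)
open import Function using (_∘_)
open import Function.Bundles using (module Equivalence)
open import Relation.Binary.PropositionalEquality using (_≡_; refl; sym; trans; cong; cong₂; subst; subst₂)

-- Boolean form of the threshold conditions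

T-∧⁻ : ∀ {x y} → T (x ∧ y) → T x × T y
T-∧⁻ = Equivalence.to T-∧

T-∧⁺ : ∀ {x y} → T x → T y → T (x ∧ y)
T-∧⁺ p q = Equivalence.from T-∧ (p , q)

-- At most one of the two truncated differences is nonzero, so their sum is the absolute difference.
dist≡∸+∸ : ∀ a b → dist a b ≡ (a ∸ b) + (b ∸ a)
dist≡∸+∸ zero    zero    = refl
dist≡∸+∸ zero    (suc b) = refl
dist≡∸+∸ (suc a) zero    = sym (+-identityʳ (suc a))
dist≡∸+∸ (suc a) (suc b) = dist≡∸+∸ a b

-- Uses ∸ rather than dist because builtin arithmetic keeps the finite checks fast.
respects : Bool → ℕ → ℕ → Bool
respects true  a b = (a ∸ b) + (b ∸ a) <ᵇ 5
respects false a b = 4 <ᵇ (a ∸ b) + (b ∸ a)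

respects-sym : ∀ l a b → T (respects l a b) → T (respects l b a)
respects-sym true  a b = subst (λ d → T (d <ᵇ 5)) (+-comm (a ∸ b) (b ∸ a))
respects-sym false a b = subst (λ d → T (4 <ᵇ d)) (+-comm (a ∸ b) (b ∸ a))

respects⇒dist : ∀ l a b → T (respects l a b) →
                (l ≡ true → dist a b ≤ 4) × (l ≡ false → 4 < dist a b)
respects⇒dist true  a b p rewrite dist≡∸+∸ a b = (λ _ → s≤s⁻¹ (<ᵇ⇒< _ 5 p)) , λ ()
respects⇒dist false a b p rewrite dist≡∸+∸ a b = (λ ()) , λ _ → <ᵇ⇒< 4 _ p

-- Colour pairs on rungs

State : Set
State = ℕ × ℕ

Rails : Set
Rails = Bool × Bool

links : Rails → State → State → Bool
links (t , b) (x , y) (x′ , y′) = respects t x x′ ∧ respects b y y′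

-- Lets a path found backwards from the last pivot be traversed forwards.
links-sym : ∀ e s s′ → T (links e s s′) → T (links e s′ s)
links-sym (t , b) (x , y) (x′ , y′) p =
  let p₁ , p₂ = T-∧⁻ {respects t x x′} p
  in T-∧⁺ {respects t x′ x} (respects-sym t x x′ p₁) (respects-sym b y y′ p₂)

fits : Bool → State → Bool
fits r (x , y) = respects r x y ∧ (x <ᵇ 31) ∧ (y <ᵇ 31)

-- The distances 3 and 6 lie on either side of the threshold 4. Both pairs sit mid-range, leaving
-- far colours above and below each coordinate.
pivot : Bool → State
pivot true  = 14 , 17
pivot false = 13 , 19

pivot-fits : ∀ r → T (fits r (pivot r))
pivot-fits true  = tt
pivot-fits false = tt

-- A set of colours found by computer search; its order only affects how early
-- the searches below succeed.
palette : List ℕ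
palette = 20 ∷ 25 ∷ 11 ∷ 21 ∷ 16 ∷ 12 ∷ 7 ∷ 15 ∷ 8 ∷ 27 ∷ []

allBool : List Bool
allBool = true ∷ false ∷ []

∈-allBool : ∀ b → b ∈ allBool
∈-allBool true  = here refl
∈-allBool false = there (here refl)

allRails : List Rails
allRails = cartesianProduct allBool allBool

∈-allRails : ∀ e → e ∈ allRails
∈-allRails (t , b) = ∈-cartesianProduct⁺ (∈-allBool t) (∈-allBool b)

-- Finite search for short paths

extends : List State → Rails → Bool → State → Bool
extends S e r s = fits r s ∧ any (λ u → links e u s) S

next : Rails × Bool → List State → List State
next (e , r) S = filter (T? ∘ extends S e r) (cartesianProduct palette palette)

∈-next⁻ : ∀ e r S {s} → s ∈ next (e , r) S →
          T (fits r s) × ∃[ u ] u ∈ S × T (links e u s)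
∈-next⁻ e r S {s} s∈ =
  let p , q = T-∧⁻ {fits r s} (proj₂ (∈-filter⁻ (T? ∘ extends S e r) s∈))
  in p , find (any⁻ (λ u → links e u s) S q)

step₁ : Bool → Rails → Bool → List State
step₁ r₀ e₀ r₁ = next (e₀ , r₁) (pivot r₀ ∷ [])

step₂ : Bool → Rails → Bool → Rails → Bool → List State
step₂ r₀ e₀ r₁ e₁ r₂ = next (e₁ , r₂) (step₁ r₀ e₀ r₁)

∈-step₁⁻ : ∀ r₀ e₀ r₁ {s} → s ∈ step₁ r₀ e₀ r₁ →
           T (fits r₁ s) × T (links e₀ (pivot r₀) s)
∈-step₁⁻ r₀ e₀ r₁ s∈ with ∈-next⁻ e₀ r₁ (pivot r₀ ∷ []) s∈
... | p , _ , here refl , q = p , q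

-- Quantification over labels becomes a list: one set for each choice of the first pivot and of the
-- labels on `k` steps, hence 2 · 8^k sets.
reachable : ℕ → List (List State)
reachable zero    = (pivot true ∷ []) ∷ (pivot false ∷ []) ∷ []
reachable (suc k) = cartesianProductWith next (cartesianProduct allRails allBool) (reachable k)

next∈reachable : ∀ k e r {S} → S ∈ reachable k → next (e , r) S ∈ reachable (suc k)
next∈reachable k e r =
  ∈-cartesianProductWith⁺ next (∈-cartesianProduct⁺ (∈-allRails e) (∈-allBool r))

step₁∈reachable : ∀ r₀ e₀ r₁ → step₁ r₀ e₀ r₁ ∈ reachable 1
step₁∈reachable true  e₀ r₁ = next∈reachable 0 e₀ r₁ (here refl)
step₁∈reachable false e₀ r₁ = next∈reachable 0 e₀ r₁ (there (here refl))

step₂∈reachable : ∀ r₀ e₀ r₁ e₁ r₂ → step₂ r₀ e₀ r₁ e₁ r₂ ∈ reachable 2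
step₂∈reachable r₀ e₀ r₁ e₁ r₂ = next∈reachable 1 e₁ r₂ (step₁∈reachable r₀ e₀ r₁)

joined : List State → List State → Rails → Bool
joined S S′ e = any (λ s → any (links e s) S′) S

-- Sets searched from both ends are compared across one middle step, so that five steps need only
-- two search layers on each side.
joinedAll : List (List State) → List (List State) → Bool
joinedAll 𝒮 𝒮′ = all (λ S → all (λ S′ → all (joined S S′) allRails) 𝒮′) 𝒮

joinedAll⇒link : ∀ 𝒮 𝒮′ → joinedAll 𝒮 𝒮′ ≡ true → ∀ {S S′} → S ∈ 𝒮 → S′ ∈ 𝒮′ → ∀ e →
                 ∃[ s ] ∃[ s′ ] s ∈ S × s′ ∈ S′ × T (links e s s′)
joinedAll⇒link 𝒮 𝒮′ p {S} {S′} S∈ S′∈ e =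
  let q              = All.lookup (all⁺ _ 𝒮 (Equivalence.from T-≡ p)) S∈
      q′             = All.lookup (all⁺ _ 𝒮′ q) S′∈
      q″             = All.lookup (all⁺ (joined S S′) allRails q′) (∈-allRails e)
      s , s∈ , a     = find (any⁻ (λ s → any (links e s) S′) S q″)
      s′ , s′∈ , l   = find (any⁻ (links e s) S′ a)
  in s , s′ , s∈ , s′∈ , l

-- Decided by evaluation, like the next two. `reachable 1` and `reachable 2` list 16 and 128 sets,
-- so the largest check has 128 · 128 · 4 cases.
joined₁₁ : joinedAll (reachable 1) (reachable 1) ≡ true
joined₁₁ = refl

joined₂₁ : joinedAll (reachable 2) (reachable 1) ≡ true
joined₂₁ = refl

joined₂₂ : joinedAll (reachable 2) (reachable 2) ≡ true
joined₂₂ = refl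

-- Walks and their concatenation

-- ρ i labels the rung i, and ε i labels the two rail edges from rung i to rung i + 1.
data Walk (ρ : ℕ → Bool) (ε : ℕ → Rails) : ℕ → State → State → Set where
  stop : ∀ {s} → T (fits (ρ 0) s) → Walk ρ ε 0 s s
  move : ∀ {n s s′ t} → T (fits (ρ 0) s) → T (links (ε 0) s s′) →
         Walk (ρ ∘ suc) (ε ∘ suc) n s′ t → Walk ρ ε (suc n) s t

-- With the offset on the left, `m +_` unfolds along with the first walk, so the shifted labels
-- agree by computation.
_++_ : ∀ {ρ ε m n s t u} → Walk ρ ε m s t → Walk (ρ ∘ (m +_)) (ε ∘ (m +_)) n t u →
       Walk ρ ε (m + n) s u
stop _     ++ w′ = w′
move p l w ++ w′ = move p l (w ++ w′)

-- Each end state depends only on the label of its rung, so consecutive walks compose and a walk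
-- around the cycle closes.
PivotWalk : (ℕ → Bool) → (ℕ → Rails) → ℕ → Set
PivotWalk ρ ε n = Walk ρ ε n (pivot (ρ 0)) (pivot (ρ n))

-- A forward path from the first pivot and a backward path from the last one are
-- joined in the middle.
pivotWalk₃ : ∀ ρ ε → PivotWalk ρ ε 3
pivotWalk₃ ρ ε =
  let s , s′ , s∈ , s′∈ , l = joinedAll⇒link (reachable 1) (reachable 1) joined₁₁
        (step₁∈reachable (ρ 0) (ε 0) (ρ 1)) (step₁∈reachable (ρ 3) (ε 2) (ρ 2)) (ε 1)
      p , k   = ∈-step₁⁻ (ρ 0) (ε 0) (ρ 1) s∈
      p′ , k′ = ∈-step₁⁻ (ρ 3) (ε 2) (ρ 2) s′∈
  in move (pivot-fits (ρ 0)) k (move p l (move p′ (links-sym (ε 2) _ s′ k′)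
     (stop (pivot-fits (ρ 3)))))

pivotWalk₄ : ∀ ρ ε → PivotWalk ρ ε 4
pivotWalk₄ ρ ε =
  let s , s′ , s∈ , s′∈ , l = joinedAll⇒link (reachable 2) (reachable 1) joined₂₁
        (step₂∈reachable (ρ 0) (ε 0) (ρ 1) (ε 1) (ρ 2)) (step₁∈reachable (ρ 4) (ε 3) (ρ 3)) (ε 2)
      p , u , u∈ , k = ∈-next⁻ (ε 1) (ρ 2) (step₁ (ρ 0) (ε 0) (ρ 1)) s∈
      q , j          = ∈-step₁⁻ (ρ 0) (ε 0) (ρ 1) u∈
      p′ , k′        = ∈-step₁⁻ (ρ 4) (ε 3) (ρ 3) s′∈
  in move (pivot-fits (ρ 0)) j (move q k (move p l (move p′ (links-sym (ε 3) _ s′ k′)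
     (stop (pivot-fits (ρ 4))))))

pivotWalk₅ : ∀ ρ ε → PivotWalk ρ ε 5
pivotWalk₅ ρ ε =
  let s , s′ , s∈ , s′∈ , l = joinedAll⇒link (reachable 2) (reachable 2) joined₂₂
        (step₂∈reachable (ρ 0) (ε 0) (ρ 1) (ε 1) (ρ 2))
        -- The backward search meets the labels in reverse order, from rung 5 down to rung 3.
        (step₂∈reachable (ρ 5) (ε 4) (ρ 4) (ε 3) (ρ 3)) (ε 2)
      p , u , u∈ , k     = ∈-next⁻ (ε 1) (ρ 2) (step₁ (ρ 0) (ε 0) (ρ 1)) s∈
      q , j              = ∈-step₁⁻ (ρ 0) (ε 0) (ρ 1) u∈
      p′ , u′ , u′∈ , k′ = ∈-next⁻ (ε 3) (ρ 3) (step₁ (ρ 5) (ε 4) (ρ 4)) s′∈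
      q′ , j′            = ∈-step₁⁻ (ρ 5) (ε 4) (ρ 4) u′∈
  in move (pivot-fits (ρ 0)) j (move q k (move p l (move p′ (links-sym (ε 3) u′ s′ k′)
     (move q′ (links-sym (ε 4) _ u′ j′) (stop (pivot-fits (ρ 5)))))))

pivotWalk : ∀ n ρ ε → PivotWalk ρ ε (3 + n)
pivotWalk 0 = pivotWalk₃
pivotWalk 1 = pivotWalk₄
pivotWalk 2 = pivotWalk₅
pivotWalk (suc (suc (suc n))) ρ ε =
  pivotWalk₃ ρ ε ++ pivotWalk n (ρ ∘ (3 +_)) (ε ∘ (3 +_))

at : ∀ {ρ ε n s t} → Walk ρ ε n s t → ℕ → State
-- At index 0 this is the final state; as a default it also serves all later indices.
at {s = s} (stop _)     _       = s
at {s = s} (move _ _ _) zero    = s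
at         (move _ _ w) (suc i) = at w i

at-start : ∀ {ρ ε n s t} (w : Walk ρ ε n s t) → at w 0 ≡ s
at-start (stop _)     = refl
at-start (move _ _ _) = refl

at-end : ∀ {ρ ε n s t} (w : Walk ρ ε n s t) → at w n ≡ t
at-end (stop _)     = refl
at-end (move _ _ w) = at-end w

at-fits : ∀ {ρ ε n s t} (w : Walk ρ ε n s t) i → i ≤ n → T (fits (ρ i) (at w i))
at-fits (stop p)     zero    _         = p
at-fits (move p _ _) zero    _         = p
at-fits (move _ _ w) (suc i) (s≤s i≤n) = at-fits w i i≤n

at-links : ∀ {ρ ε n s t} (w : Walk ρ ε n s t) i → i < n →
           T (links (ε i) (at w i) (at w (suc i)))
at-links {ε = ε} (move {s = s} _ l w) zero _ =
  subst (λ u → T (links (ε 0) s u)) (sym (at-start w)) l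
at-links (move _ _ w) (suc i) (s≤s i<n) = at-links w i i<n

-- The walk closed up around the prism

module Colouring (k : ℕ) (L : NearFarLabeling (Cycle (2 + k) □ K2)) where

  -- `Cycle (2 + k)` has `suc m` = 3 + k vertices, the length of the walk given by `pivotWalk k`.
  m : ℕ
  m = 2 + k

  -- Unrolls the cycle, so that labels become sequences over ℕ and walks need no wrap-around.
  rung : ℕ → Fin (suc m)
  rung i = i mod suc m

  rung-toℕ : ∀ v → rung (toℕ v) ≡ v
  rung-toℕ v = toℕ-injective
    (trans (toℕ-fromℕ< (m%n<n (toℕ v) (suc m))) (m<n⇒m%n≡m (toℕ<n v)))

  rung-suc : ∀ (v x : Fin (suc m)) → toℕ x ≡ suc (toℕ v) % suc m → rung (suc (toℕ v)) ≡ x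
  rung-suc v x eq =
    toℕ-injective (trans (toℕ-fromℕ< (m%n<n (suc (toℕ v)) (suc m))) (sym eq))

  rung-wrap : rung (suc m) ≡ rung 0
  rung-wrap = toℕ-injective (trans (toℕ-fromℕ< (m%n<n (suc m) (suc m))) (n%n≡0 (suc m)))

  rungLabel : Fin (suc m) → Bool
  rungLabel v = near L (v , zero) (v , suc zero)

  railLabels : Fin (suc m) → Fin (suc m) → Rails
  railLabels v x = near L (v , zero) (x , zero) , near L (v , suc zero) (x , suc zero)

  ρ : ℕ → Bool
  ρ = rungLabel ∘ rung

  ε : ℕ → Rails
  ε i = railLabels (rung i) (rung (suc i))

  walk : PivotWalk ρ ε (suc m)
  walk = pivotWalk k ρ ε

  pair : Fin (suc m) → State
  pair v = at walk (toℕ v)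

  pair-fits : ∀ v → T (fits (rungLabel v) (pair v))
  pair-fits v = subst (λ z → T (fits (rungLabel z) (pair v))) (rung-toℕ v)
    (at-fits walk (toℕ v) (<⇒≤ (toℕ<n v)))

  -- Index `suc m` is rung 0 again, so both ends carry the pivot of the same label.
  at-wrap : at walk (suc m) ≡ at walk 0
  at-wrap = trans (at-end walk) (trans (cong (pivot ∘ rungLabel) rung-wrap) (sym (at-start walk)))

  -- Makes the edge from the last rung back to the first an ordinary step; the bound includes the
  -- wrap-around index `suc m`.
  at-% : ∀ i → i ≤ suc m → at walk (i % suc m) ≡ at walk i
  at-% i i≤n with m≤n⇒m<n∨m≡n i≤n
  ... | inj₁ i<n  = cong (at walk) (m<n⇒m%n≡m i<n)
  ... | inj₂ refl = trans (cong (at walk) (n%n≡0 (suc m))) (sym at-wrap)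

  pair-links : ∀ v x → toℕ x ≡ suc (toℕ v) % suc m → T (links (railLabels v x) (pair v) (pair x))
  pair-links v x eq =
    -- The inner `subst` returns from unrolled to actual rail labels; the outer one reduces the end
    -- index modulo `suc m`.
    subst (λ u → T (links (railLabels v x) (pair v) u))
      (trans (sym (at-% (suc (toℕ v)) (toℕ<n v))) (cong (at walk) (sym eq)))
      (subst (λ e → T (links e (pair v) (at walk (suc (toℕ v)))))
        (cong₂ railLabels (rung-toℕ v) (rung-suc v x eq))
        (at-links walk (toℕ v) (toℕ<n v)))

  coord : Fin 2 → State → ℕ
  coord zero       = proj₁
  coord (suc zero) = proj₂

  colour : Fin (suc m) × Fin 2 → ℕ
  colour (v , w) = coord w (pair v)

  colour<31 : ∀ u → colour u < 31
  colour<31 (v , w) with T-∧⁻ {respects (rungLabel v) (proj₁ (pair v)) (proj₂ (pair v))} (pair-fits v)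
  ... | _ , q with T-∧⁻ {proj₁ (pair v) <ᵇ 31} q | w
  ... | p , _ | zero     = <ᵇ⇒< _ 31 p
  ... | _ , p | suc zero = <ᵇ⇒< _ 31 p

  rung-respects : ∀ v → T (respects (rungLabel v) (colour (v , zero)) (colour (v , suc zero)))
  rung-respects v = proj₁ (T-∧⁻ (pair-fits v))

  rail-respects : ∀ v x w → toℕ x ≡ suc (toℕ v) % suc m →
                  T (respects (near L (v , w) (x , w)) (colour (v , w)) (colour (x , w)))
  rail-respects v x zero       eq = proj₁ (T-∧⁻ (pair-links v x eq))
  rail-respects v x (suc zero) eq =
    proj₂ (T-∧⁻ {respects (near L (v , zero) (x , zero)) (proj₁ (pair v)) (proj₁ (pair x))} (pair-links v x eq))

  -- Labels and distances are symmetric, so each edge need only be treated in one direction.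
  flip-respects : ∀ u v → T (respects (near L u v) (colour u) (colour v)) →
                  T (respects (near L v u) (colour v) (colour u))
  flip-respects u v = subst (λ l → T (respects l (colour v) (colour u))) (near-sym L u v)
    ∘ respects-sym (near L u v) (colour u) (colour v)

  colour-respects : ∀ u v → Adj (Cycle m □ K2) u v → T (respects (near L u v) (colour u) (colour v))
  colour-respects (v , zero)     (_ , suc zero) (inj₁ (refl , _)) = rung-respects v
  colour-respects (v , suc zero) (_ , zero)     (inj₁ (refl , _)) =
    flip-respects (v , zero) (v , suc zero) (rung-respects v)
  colour-respects (v , zero)     (_ , zero)     (inj₁ (refl , inj₁ (_ , ())))
  colour-respects (v , zero)     (_ , zero)     (inj₁ (refl , inj₂ (() , _)))
  colour-respects (v , suc zero) (_ , suc zero) (inj₁ (refl , inj₁ (() , _)))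
  colour-respects (v , suc zero) (_ , suc zero) (inj₁ (refl , inj₂ (_ , ())))
  colour-respects (v , w) (x , _) (inj₂ (refl , inj₁ eq)) = rail-respects v x w eq
  colour-respects (v , w) (x , _) (inj₂ (refl , inj₂ eq)) =
    flip-respects (x , w) (v , w) (rail-respects x v w eq)

  colouring : Fin (suc m) × Fin 2 → Fin 31
  colouring u = fromℕ< (colour<31 u)

  toℕ-colouring : ∀ u → toℕ (colouring u) ≡ colour u
  toℕ-colouring u = toℕ-fromℕ< (colour<31 u)

  isThresholdColoring : IsThresholdColoring (Cycle m □ K2) 31 4 L colouring
  isThresholdColoring u v uv = respects⇒dist (near L u v) _ _
    (subst₂ (λ a b → T (respects (near L u v) a b)) (sym (toℕ-colouring u)) (sym (toℕ-colouring v))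
      (colour-respects u v uv))

theorem1 : (n : ℕ) → 3 ≤ n → TotalThresholdColorable 31 4 (Cycle (n ∸ 1) □ K2)
theorem1 (suc (suc (suc k))) (s≤s (s≤s (s≤s _))) L = colouring , isThresholdColoring
  where open Colouring k L
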